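{- Let $A$ be a unital C*-algebra and let $pMO(A)$ be the locale presented by the site $\mathcal{C}(A)\ltimes\Sigma$ described in the context. Then the points of $pMO(A)$ are in one-to-one correspondence with the consistent ideals of partial measurement outcomes of $A$. Explicitly: a point $\tau$ (completely prime filter) corresponds to the family indexed by $I_\tau=\{C\in\mathcal{C}(A) : (C,\Sigma(C))\in\tau\}$, where for $C\in I_\tau$ the character $\sigma_C\in\Sigma(C)$ is the unique character with $\{u : (C,u)\in\tau\}=\{u\in\mathcal{O}(\Sigma(C)) : \sigma_C\in u\}$; conversely, a consistent ideal $(C_i,\sigma_i)_{i}$ corresponds to the point $\{(C_i,u) : \sigma_i\in u\}$.
   Context: Work classically in Sets. $A$ is a unital C*-algebra; $\mathcal{C}(A)$ denotes the set of commutative unital C*-subalgebras of $A$, partially ordered by inclusion. For $C\in\mathcal{C}(A)$, $\Sigma(C)$ is its Gelfand spectrum (the compact Hausdorff space of characters of $C$) and $\mathcal{O}(\Sigma(C))$ its lattice of open sets. For $C\subseteq D$ in $\mathcal{C}(A)$, $r_{D,C}:\Sigma(D)\to\Sigma(C)$ is restriction of characters (continuous). The site $\mathcal{C}(A)\ltimes\Sigma$: objects are pairs $(C,u)$ with $C\in\mathcal{C}(A)$, $u\in\mathcal{O}(\Sigma(C))$; order $(D,v)\le(C,u)$ iff $C\subseteq D$ and $v\subseteq r_{D,C}^{ -1}(u)$; covering relation $(C,u)\lhd\{(D_i,v_i)\}_{i\in I}$ iff $C\subseteq D_i$ for all $i$ and $u\subseteq\bigcup\{v_i : i\in I, D_i=C\}$.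 The locale presented by such a site has as frame the down-closed subsets $U$ of the poset such that $x\lhd S\subseteq U$ implies $x\in U$. A point of it is a completely prime filter: an inhabited, up-closed subset $\tau$ such that any two elements of $\tau$ have a common lower bound in $\tau$, and whenever $x\in\tau$ and $x\lhd S$ then $S\cap\tau\neq\emptyset$. A partial measurement outcome is a pair $(C,\sigma)$ with $C\in\mathcal{C}(A)$ and $\sigma\in\Sigma(C)$. A consistent ideal of partial measurement outcomes is a family $(C_i,\sigma_i)_{i}$ of partial measurement outcomes such that $\{C_i\}$ is an ideal of $\mathcal{C}(A)$ (nonempty, down-closed, and directed under inclusion), each $C_i$ occurs with exactly one $\sigma_i$, and $C_i\subseteq C_j$ implies $\sigma_i=\sigma_j|_{C_i}$. -}

module Defs where

open import Level using (Level; suc)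
open import Algebra.Bundles using (AbelianGroup; Ring; CommutativeRing)
open import Algebra.Module.Structures using (IsLeftModule)
import Algebra.Construct.DirectProduct as DirectProduct
import Algebra.Properties.Ring as RingProperties
import Algebra.Solver.Ring.NaturalCoefficients.Default as SemiringSolver
open import Data.List.Base using (List)
open import Data.List.Relation.Unary.All using (All)
open import Data.Nat.Base as ℕ using (ℕ)
open import Data.Product.Base using (Σ-syntax; ∃; ∃-syntax; _×_; _,_; proj₁; proj₂)
open import Data.Unit.Polymorphic.Base using (⊤)
open import Function.Bundles using (_⇔_)
open import Function.Properties.Equivalence using (⇔-isEquivalence)
open import Relation.Binary.Bundles using (Setoid; Poset)
open import Relation.Binary.Core using (Rel)
open import Relation.Binary.Definitions using (_Respects_)
open import Relation.Binary.Structures using (IsEquivalence; IsTotalOrder)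
import Relation.Binary.Construct.Interior.Symmetric as Symmetric
open import Relation.Nullary.Negation.Core using (¬_)
open import Relation.Unary using (Pred; _∈_; _⊆_)

-- Dedekind-complete ordered fields. Classically these are exactly the models
-- of ℝ; everything below is stated over an arbitrary one.
record CompleteOrderedField (ℓ : Level) : Set (suc ℓ) where
  field
    commutativeRing : CommutativeRing ℓ ℓ
  open CommutativeRing commutativeRing public
  infix 4 _≤_ _<_
  field
    _≤_          : Rel Carrier ℓ
    isTotalOrder : IsTotalOrder _≈_ _≤_
    0≉1          : ¬ 0# ≈ 1#
    inverse      : ∀ x → ¬ x ≈ 0# → ∃[ y ] x * y ≈ 1#
    +-monoʳ-≤    : ∀ x {y z} → y ≤ z → x + y ≤ x + z
    *-nonneg     : ∀ {x y} → 0# ≤ x → 0# ≤ y → 0# ≤ x * y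

  _<_ : Rel Carrier ℓ
  x < y = x ≤ y × ¬ x ≈ y

  UpperBound : Pred Carrier ℓ → Pred Carrier ℓ
  UpperBound P b = ∀ x → x ∈ P → x ≤ b

  field
    supremum : (P : Pred Carrier ℓ) → ∃ P → ∃ (UpperBound P) →
               ∃[ s ] (UpperBound P s × (∀ b → UpperBound P b → s ≤ b))

module Complex {ℓ} (ℝ : CompleteOrderedField ℓ) where
  private
    module ℝ = CompleteOrderedField ℝ
    open RingProperties ℝ.ring using (-‿distribˡ-*; -‿distribʳ-*; -‿+-comm)
    open SemiringSolver ℝ.commutativeSemiring using (solve; _:=_; _:+_; _:*_)

    +-group : AbelianGroup ℓ ℓ
    +-group = DirectProduct.abelianGroup ℝ.+-abelianGroup ℝ.+-abelianGroup
    module + = AbelianGroup +-group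

  -- Pairs (re , im).
  ℂ : Set ℓ
  ℂ = +.Carrier

  infixl 7 _*_
  _*_ : ℂ → ℂ → ℂ
  (a , b) * (c , d) = (a ℝ.* c ℝ.+ ℝ.- (b ℝ.* d)) , (a ℝ.* d ℝ.+ b ℝ.* c)

  1ℂ : ℂ
  1ℂ = ℝ.1# , ℝ.0#

  conj : ℂ → ℂ
  conj (a , b) = a , ℝ.- b

  -- The squared modulus.
  ∣_∣² : ℂ → ℝ.Carrier
  ∣ a , b ∣² = a ℝ.* a ℝ.+ b ℝ.* b

  private
    *-cong : ∀ {x y u v} → x +.≈ y → u +.≈ v → (x * u) +.≈ (y * v)
    *-cong (p , q) (r , s) =
      ℝ.+-cong (ℝ.*-cong p r) (ℝ.-‿cong (ℝ.*-cong q s)) ,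
      ℝ.+-cong (ℝ.*-cong p s) (ℝ.*-cong q r)

    -- The solver handles semirings only: negations are first pushed onto
    -- variables, and negated variables are then treated as atoms.
    negˡ : ∀ {x y z} → x ℝ.+ ℝ.- (y ℝ.* z) ℝ.≈ x ℝ.+ ℝ.- y ℝ.* z
    negˡ = ℝ.+-congˡ (-‿distribˡ-* _ _)

    negʳ : ∀ {x y z} → x ℝ.+ ℝ.- (y ℝ.* z) ℝ.≈ x ℝ.+ y ℝ.* ℝ.- z
    negʳ = ℝ.+-congˡ (-‿distribʳ-* _ _)

    *-assoc : ∀ x y z → ((x * y) * z) +.≈ (x * (y * z))
    *-assoc (a , b) (c , d) (e , f) =
      ℝ.trans
        (ℝ.trans negˡ
          (ℝ.+-cong (ℝ.*-congʳ negˡ)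
            (ℝ.*-congʳ (ℝ.trans (ℝ.sym (-‿+-comm _ _))
              (ℝ.+-cong (-‿distribʳ-* a d) (-‿distribˡ-* b c))))))
        (ℝ.trans
          (solve 7 (λ a nb c d nd e f →
            ((a :* c :+ nb :* d) :* e :+ (a :* nd :+ nb :* c) :* f) :=
            (a :* (c :* e :+ nd :* f) :+ nb :* (c :* f :+ d :* e)))
            ℝ.refl a (ℝ.- b) c d (ℝ.- d) e f)
          (ℝ.sym (ℝ.trans negˡ (ℝ.+-congʳ (ℝ.*-congˡ negˡ))))) ,
      ℝ.trans (ℝ.+-congʳ (ℝ.*-congʳ negʳ))
        (ℝ.trans
          (solve 7 (λ a b c d nd e f →
            ((a :* c :+ b :* nd) :* f :+ (a :* d :+ b :* c) :* e) :=
            (a :* (c :* f :+ d :* e) :+ b :* (c :* e :+ nd :* f)))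
            ℝ.refl a b c d (ℝ.- d) e f)
          (ℝ.sym (ℝ.+-congˡ (ℝ.*-congˡ negˡ))))

    *-comm : ∀ x y → (x * y) +.≈ (y * x)
    *-comm (a , b) (c , d) =
      ℝ.+-cong (ℝ.*-comm a c) (ℝ.-‿cong (ℝ.*-comm b d)) ,
      ℝ.trans (ℝ.+-comm _ _) (ℝ.+-cong (ℝ.*-comm b c) (ℝ.*-comm a d))

    *-distribˡ : ∀ x y z → (x * (y +.∙ z)) +.≈ ((x * y) +.∙ (x * z))
    *-distribˡ (a , b) (c , d) (e , f) =
      ℝ.trans negˡ
        (ℝ.trans
          (solve 6 (λ a nb c d e f →
            (a :* (c :+ e) :+ nb :* (d :+ f)) :=
            ((a :* c :+ nb :* d) :+ (a :* e :+ nb :* f)))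
            ℝ.refl a (ℝ.- b) c d e f)
          (ℝ.sym (ℝ.+-cong negˡ negˡ))) ,
      solve 6 (λ a b c d e f →
        (a :* (d :+ f) :+ b :* (c :+ e)) :=
        ((a :* d :+ b :* c) :+ (a :* f :+ b :* e)))
        ℝ.refl a b c d e f

    *-identityˡ : ∀ x → (1ℂ * x) +.≈ x
    *-identityˡ (a , b) =
      ℝ.trans (ℝ.+-cong (ℝ.*-identityˡ a)
                 (ℝ.trans (ℝ.-‿cong (ℝ.zeroˡ b))
                   (ℝ.trans (ℝ.sym (ℝ.+-identityˡ _)) (ℝ.-‿inverseʳ ℝ.0#))))
              (ℝ.+-identityʳ a) ,
      ℝ.trans (ℝ.+-cong (ℝ.*-identityˡ b) (ℝ.zeroˡ a)) (ℝ.+-identityʳ b)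

  commutativeRing : CommutativeRing ℓ ℓ
  commutativeRing = record
    { isCommutativeRing = record
      { isRing = record
        { +-isAbelianGroup = +.isAbelianGroup
        ; *-cong     = *-cong
        ; *-assoc    = *-assoc
        ; *-identity = *-identityˡ ,
                       λ x → +.trans (*-comm x 1ℂ) (*-identityˡ x)
        ; distrib    = *-distribˡ ,
                       λ x y z → +.trans (*-comm (y +.∙ z) x)
                         (+.trans (*-distribˡ x y z)
                           (+.∙-cong (*-comm x y) (*-comm x z)))
        }
      ; *-comm = *-comm
      }
    }

-- Unital C*-algebras; the zero algebra is allowed.
record CStarAlgebra {ℓ} (ℝ : CompleteOrderedField ℓ) : Set (suc ℓ) where
  private
    module ℝ = CompleteOrderedField ℝ
    open Complex ℝ using (ℂ; conj; ∣_∣²)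
    module ℂ = CommutativeRing (Complex.commutativeRing ℝ)
  field
    ring : Ring ℓ ℓ
  open Ring ring public
  infixr 8 _·_
  infix 9 _⋆
  field
    _·_          : ℂ → Carrier → Carrier
    isLeftModule : IsLeftModule ℂ.ring _≈_ _+_ 0# -_ _·_
    ·-*-assoc    : ∀ z a b → (z · a) * b ≈ z · (a * b)
    *-·-comm     : ∀ z a b → a * (z · b) ≈ z · (a * b)

    _⋆           : Carrier → Carrier
    ⋆-cong       : ∀ {a b} → a ≈ b → a ⋆ ≈ b ⋆
    ⋆-involutive : ∀ a → (a ⋆) ⋆ ≈ a
    ⋆-+          : ∀ a b → (a + b) ⋆ ≈ a ⋆ + b ⋆
    ⋆-·          : ∀ z a → (z · a) ⋆ ≈ conj z · (a ⋆)
    ⋆-*          : ∀ a b → (a * b) ⋆ ≈ b ⋆ * a ⋆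

    ‖_‖          : Carrier → ℝ.Carrier
    ‖‖-cong      : ∀ {a b} → a ≈ b → ‖ a ‖ ℝ.≈ ‖ b ‖
    ‖‖-nonneg    : ∀ a → ℝ.0# ℝ.≤ ‖ a ‖
    ‖‖-definite  : ∀ a → ‖ a ‖ ℝ.≈ ℝ.0# → a ≈ 0#
    ‖‖-triangle  : ∀ a b → ‖ a + b ‖ ℝ.≤ ‖ a ‖ ℝ.+ ‖ b ‖
    -- ‖ z · a ‖ = ∣ z ∣ ‖ a ‖, squared to avoid square roots in ℝ.
    ‖‖-·         : ∀ z a → ‖ z · a ‖ ℝ.* ‖ z · a ‖ ℝ.≈ ∣ z ∣² ℝ.* (‖ a ‖ ℝ.* ‖ a ‖)
    ‖‖-*         : ∀ a b → ‖ a * b ‖ ℝ.≤ ‖ a ‖ ℝ.* ‖ b ‖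
    ‖‖-⋆         : ∀ a → ‖ a ⋆ * a ‖ ℝ.≈ ‖ a ‖ ℝ.* ‖ a ‖

  Cauchy : Pred (ℕ → Carrier) ℓ
  Cauchy s = ∀ ε → ℝ.0# ℝ.< ε →
    ∃[ N ] ∀ m n → N ℕ.≤ m → N ℕ.≤ n → ‖ s m - s n ‖ ℝ.< ε

  ConvergesTo : (ℕ → Carrier) → Pred Carrier ℓ
  ConvergesTo s a = ∀ ε → ℝ.0# ℝ.< ε → ∃[ N ] ∀ n → N ℕ.≤ n → ‖ s n - a ‖ ℝ.< ε

  field
    complete : ∀ s → Cauchy s → ∃ (ConvergesTo s)

record Site (s ℓ : Level) : Set (suc (s Level.⊔ ℓ)) where
  field
    poset : Poset s ℓ ℓ
  open Poset poset public
  infix 4 _◁_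
  field
    _◁_ : Carrier → Pred Carrier s → Set s

module _ {s ℓ} (𝕊 : Site s ℓ) where
  open Site 𝕊

  -- Points of the locale presented by 𝕊 (whose frame consists of the down-closed
  -- U such that x ◁ S ⊆ U implies x ∈ U), as completely prime filters on 𝕊.
  record Point : Set (suc (s Level.⊔ ℓ)) where
    field
      filter    : Pred Carrier s
      inhabited : ∃ filter
      upClosed  : ∀ {x y} → x ≤ y → x ∈ filter → y ∈ filter
      filtered  : ∀ {x y} → x ∈ filter → y ∈ filter →
                  ∃[ z ] (z ∈ filter × z ≤ x × z ≤ y)
      prime     : ∀ {x} S → x ∈ filter → x ◁ S → ∃[ y ] (y ∈ S × y ∈ filter)

  open Point

  pointSetoid : Setoid (suc (s Level.⊔ ℓ)) s
  pointSetoid = record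
    { Carrier = Point
    ; _≈_ = λ τ υ → ∀ x → x ∈ filter τ ⇔ x ∈ filter υ
    ; isEquivalence = record
      { refl  = λ x → ⇔.refl
      ; sym   = λ p x → ⇔.sym (p x)
      ; trans = λ p q x → ⇔.trans (p x) (q x)
      }
    }
    where module ⇔ = IsEquivalence (⇔-isEquivalence {s})

module MeasurementOutcomes {ℓ} {ℝ : CompleteOrderedField ℓ} (A : CStarAlgebra ℝ) where
  private
    module ℝ = CompleteOrderedField ℝ
    open Complex ℝ using (∣_∣²)
    module ℂ = CommutativeRing (Complex.commutativeRing ℝ)
    module A = CStarAlgebra A

  record CommSubalgebra : Set (suc ℓ) where
    field
      carrier     : Pred A.Carrier ℓ
      respects    : carrier Respects A._≈_
      1∈          : A.1# ∈ carrier
      +-closed    : ∀ {a b} → a ∈ carrier → b ∈ carrier → a A.+ b ∈ carrier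
      *-closed    : ∀ {a b} → a ∈ carrier → b ∈ carrier → a A.* b ∈ carrier
      ·-closed    : ∀ z {a} → a ∈ carrier → z A.· a ∈ carrier
      ⋆-closed    : ∀ {a} → a ∈ carrier → a A.⋆ ∈ carrier
      norm-closed : ∀ s → (∀ n → s n ∈ carrier) → ∀ {a} → A.ConvergesTo s a → a ∈ carrier
      commutative : ∀ {a b} → a ∈ carrier → b ∈ carrier → a A.* b A.≈ b A.* a

    Element : Set ℓ
    Element = ∃ carrier

  open CommSubalgebra using (carrier; Element)

  𝒞 : Poset (suc ℓ) ℓ ℓ
  𝒞 = Symmetric.poset {A = CommSubalgebra} {R = λ C D → carrier C ⊆ carrier D}
        (λ p → p) (λ p q r → q (p r))

  open Poset 𝒞 public using () renaming (_≤_ to _⊑_; _≈_ to _≋_)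

  -- Nonzero multiplicative linear functionals. `cong` makes the value
  -- independent of the membership proof.
  record Character (C : CommSubalgebra) : Set ℓ where
    private module C = CommSubalgebra C
    field
      ⟦_⟧     : Element C → ℂ.Carrier
      cong    : ∀ {a b} → proj₁ a A.≈ proj₁ b → ⟦ a ⟧ ℂ.≈ ⟦ b ⟧
      +-homo  : ∀ {a b} (p : a ∈ carrier C) (q : b ∈ carrier C) →
                ⟦ a A.+ b , C.+-closed p q ⟧ ℂ.≈ ⟦ a , p ⟧ ℂ.+ ⟦ b , q ⟧
      *-homo  : ∀ {a b} (p : a ∈ carrier C) (q : b ∈ carrier C) →
                ⟦ a A.* b , C.*-closed p q ⟧ ℂ.≈ ⟦ a , p ⟧ ℂ.* ⟦ b , q ⟧
      ·-homo  : ∀ z {a} (p : a ∈ carrier C) →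
                ⟦ z A.· a , C.·-closed z p ⟧ ℂ.≈ z ℂ.* ⟦ a , p ⟧
      nonzero : ∃[ a ] ¬ ⟦ a ⟧ ℂ.≈ ℂ.0#

  open Character using (⟦_⟧)

  infix 4 _≐_
  _≐_ : ∀ {C} → Rel (Character C) ℓ
  σ ≐ ρ = ∀ a → ⟦ σ ⟧ a ℂ.≈ ⟦ ρ ⟧ a

  r : ∀ {C D} → C ⊑ D → Character D → Character C
  r {C} {D} C⊑D σ = record
    { ⟦_⟧     = λ (a , p) → ⟦ σ ⟧ (a , C⊑D p)
    ; cong    = σ.cong
    ; +-homo  = λ p q → ℂ.trans (σ.cong A.refl) (σ.+-homo (C⊑D p) (C⊑D q))
    ; *-homo  = λ p q → ℂ.trans (σ.cong A.refl) (σ.*-homo (C⊑D p) (C⊑D q))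
    ; ·-homo  = λ z p → ℂ.trans (σ.cong A.refl) (σ.·-homo z (C⊑D p))
    ; nonzero = (A.1# , C.1∈) , λ σ1≈0 →
        let (a , p) , σa≉0 = σ.nonzero in
        σa≉0 (ℂ.trans (σ.cong (A.sym (A.*-identityˡ a)))
             (ℂ.trans (σ.*-homo (C⊑D C.1∈) p)
             (ℂ.trans (ℂ.*-congʳ σ1≈0) (ℂ.zeroˡ _))))
    }
    where
    module σ = Character σ
    module C = CommSubalgebra C

  -- A basic neighbourhood of σ in the weak-* topology:
  -- ∣ ρ a - σ a ∣² < ε for the finitely many a in as.
  Near : ∀ {C} → Character C → List (Element C) → ℝ.Carrier → Pred (Character C) ℓ
  Near σ as ε ρ = All (λ a → ∣ ⟦ ρ ⟧ a ℂ.- ⟦ σ ⟧ a ∣² ℝ.< ε) as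

  record Open (C : CommSubalgebra) : Set (suc ℓ) where
    field
      points   : Pred (Character C) ℓ
      respects : points Respects _≐_
      isOpen   : ∀ {σ} → σ ∈ points → ∃[ as ] ∃[ ε ] (ℝ.0# ℝ.< ε × Near σ as ε ⊆ points)

  open Open public using (points)

  full : ∀ C → Open C
  full C = record
    { points   = λ _ → ⊤
    ; respects = λ _ _ → _
    ; isOpen   = λ _ → List.[] , ℝ.1# , 0<1 , λ _ → _
    }
    where
    open RingProperties ℝ.ring using (-‿distribˡ-*; -‿involutive)
    open import Data.Sum.Base using (inj₁; inj₂)
    module ≤ = IsTotalOrder ℝ.isTotalOrder
    0≤1 : ℝ.0# ℝ.≤ ℝ.1#
    0≤1 with ≤.total ℝ.0# ℝ.1#
    ... | inj₁ p = p
    ... | inj₂ 1≤0 = ≤.≤-respʳ-≈ -1*-1≈1 (ℝ.*-nonneg 0≤-1 0≤-1)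
      where
      0≤-1 : ℝ.0# ℝ.≤ ℝ.- ℝ.1#
      0≤-1 = ≤.≤-respʳ-≈ (ℝ.+-identityʳ _)
               (≤.≤-respˡ-≈ (ℝ.-‿inverseˡ ℝ.1#) (ℝ.+-monoʳ-≤ (ℝ.- ℝ.1#) 1≤0))
      -1*-1≈1 : ℝ.- ℝ.1# ℝ.* ℝ.- ℝ.1# ℝ.≈ ℝ.1#
      -1*-1≈1 = ℝ.trans (ℝ.sym (-‿distribˡ-* _ _))
                  (ℝ.trans (ℝ.-‿cong (ℝ.*-identityˡ _)) (-‿involutive _))
    0<1 : ℝ.0# ℝ.< ℝ.1#
    0<1 = 0≤1 , ℝ.0≉1

  SiteObject : Set (suc ℓ)
  SiteObject = ∃ Open

  -- (D , v) ⊴ (C , u) iff C ⊑ D and v ⊆ r⁻¹ u.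
  infix 4 _⊴_
  _⊴_ : Rel SiteObject ℓ
  (D , v) ⊴ (C , u) = Σ[ C⊑D ∈ C ⊑ D ] (∀ {ρ} → ρ ∈ points v → r C⊑D ρ ∈ points u)

  ⊴-refl : ∀ {x} → x ⊴ x
  ⊴-refl {C , u} = (λ p → p) , λ {ρ} → Open.respects u (λ _ → Character.cong ρ A.refl)

  ⊴-trans : ∀ {x y z} → x ⊴ y → y ⊴ z → x ⊴ z
  ⊴-trans {z = C , u} (p , f) (q , g) =
    (λ m → p (q m)) , λ {ρ} m → Open.respects u (λ _ → Character.cong ρ A.refl) (g (f m))

  -- Membership of σ in ⋃ { v : (D , v) ∈ S, D = C } transports σ along the
  -- equality of subalgebras D ≋ C by restriction.
  𝒞⋉Σ : Site (suc ℓ) ℓ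
  𝒞⋉Σ = record
    { poset = Symmetric.poset {R = _⊴_}
                (λ {x} → ⊴-refl {x}) (λ {x} {y} {z} → ⊴-trans {x} {y} {z})
    ; _◁_ = λ (C , u) S →
        (∀ D v → (D , v) ∈ S → C ⊑ D) ×
        (∀ σ → σ ∈ points u →
          ∃[ D ] ∃[ v ] Σ[ D≋C ∈ D ≋ C ]
            ((D , v) ∈ S × r (Symmetric.lhs≤rhs D≋C) σ ∈ points v))
    }

  Outcome : Set (suc ℓ)
  Outcome = ∃ Character

  infix 4 _≈ᵒ_
  _≈ᵒ_ : Rel Outcome ℓ
  (C , σ) ≈ᵒ (D , ρ) = Σ[ C≋D ∈ C ≋ D ] σ ≐ r (Symmetric.lhs≤rhs C≋D) ρ

  -- A consistent ideal, as the set of outcomes occurring in the family.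
  record ConsistentIdeal : Set (suc (suc ℓ)) where
    field
      outcomes : Pred Outcome (suc ℓ)
      respects : outcomes Respects _≈ᵒ_

    Index : Pred CommSubalgebra (suc ℓ)
    Index C = ∃[ σ ] (C , σ) ∈ outcomes

    field
      nonempty   : ∃ Index
      downClosed : ∀ {C D} → C ⊑ D → D ∈ Index → C ∈ Index
      directed   : ∀ {C D} → C ∈ Index → D ∈ Index → ∃[ E ] (E ∈ Index × C ⊑ E × D ⊑ E)
      unique     : ∀ {C σ ρ} → (C , σ) ∈ outcomes → (C , ρ) ∈ outcomes → σ ≐ ρ
      consistent : ∀ {C D σ ρ} → (C , σ) ∈ outcomes → (D , ρ) ∈ outcomes →
                   (C⊑D : C ⊑ D) → σ ≐ r C⊑D ρ

  open ConsistentIdeal public using (outcomes; Index)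

  idealSetoid : Setoid (suc (suc ℓ)) (suc ℓ)
  idealSetoid = record
    { Carrier = ConsistentIdeal
    ; _≈_ = λ F G → ∀ x → x ∈ outcomes F ⇔ x ∈ outcomes G
    ; isEquivalence = record
      { refl  = λ x → ⇔.refl
      ; sym   = λ p x → ⇔.sym (p x)
      ; trans = λ p q x → ⇔.trans (p x) (q x)
      }
    }
    where module ⇔ = IsEquivalence (⇔-isEquivalence {suc ℓ})

  I : Point 𝒞⋉Σ → Pred CommSubalgebra (suc ℓ)
  I τ C = (C , full C) ∈ Point.filter τ

  -- { u : (C , u) ∈ τ } = { u : σ ∈ u }.
  Determines : Point 𝒞⋉Σ → ∀ {C} → Pred (Character C) (suc ℓ)
  Determines τ {C} σ = ∀ (u : Open C) → (C , u) ∈ Point.filter τ ⇔ σ ∈ points u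

{-# OPTIONS --safe #-}

-- For a fixed C, the sets u with (C , u) ∈ τ form a completely prime filter of
-- opens of Σ(C), so the first half of the theorem is sobriety of Σ(C), which
-- follows from its being Hausdorff (compactness plays no role). If every
-- character had a neighbourhood outside the filter, these neighbourhoods would
-- cover Σ(C); hence some σ has all its neighbourhoods in the filter. If u is in
-- the filter but σ ∉ u, then u is covered by opens v disjoint from some
-- neighbourhood w of σ, so the filter contains disjoint v and w, hence the
-- empty set, which has the empty cover. Pulling opens back along restriction
-- shows that the characters at different C are compatible.
module Submission where

open import Defs
open import Level using (Level; suc; lift; lower)
open import Axiom.ExcludedMiddle using (ExcludedMiddle)
open import Algebra.Bundles using (CommutativeRing)
import Algebra.Properties.Ring as RingProperties
open import Data.Empty.Polymorphic using (⊥)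
open import Data.List.Base using ([]; _∷_; _++_; map)
open import Data.List.Relation.Unary.All as All using ([]; _∷_)
open import Data.List.Relation.Unary.All.Properties using (++⁻; map⁻)
open import Data.Product.Base using (Σ-syntax; ∃-syntax; _×_; _,_; proj₁; proj₂)
open import Data.Sum.Base using (_⊎_; inj₁; inj₂)
open import Data.Unit.Polymorphic.Base using (tt)
open import Function.Base using (_∘_; case_of_)
open import Function.Bundles using (Inverse; Equivalence; _⇔_; mk⇔)
open import Relation.Binary.Bundles using (Poset; Setoid; TotalOrder)
import Relation.Binary.Construct.Interior.Symmetric as Symmetric
import Relation.Binary.Properties.TotalOrder as TotalOrderProperties
import Relation.Binary.Reasoning.PartialOrder as PartialOrderReasoning
open import Relation.Nullary.Decidable.Core using (yes; no; map′; decidable-stable)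
open import Relation.Nullary.Negation.Core using (¬_; contradiction)
open import Relation.Unary using (_∈_; _≬_)

open Equivalence using (to; from)

-- Arithmetic in an ordered field.

module OrderedFieldProperties {ℓ} (ℝ : CompleteOrderedField ℓ) where
  open CompleteOrderedField ℝ
  open RingProperties ring public

  totalOrder : TotalOrder ℓ ℓ ℓ
  totalOrder = record { isTotalOrder = isTotalOrder }

  open TotalOrder totalOrder public
    using (total; antisym; ≤-respˡ-≈; ≤-respʳ-≈) renaming (refl to ≤-refl; trans to ≤-trans)
  open TotalOrderProperties totalOrder public
    using (≰⇒>; <⇒≱; <-respˡ-≈; <-respʳ-≈; <-asym)
  open PartialOrderReasoning (TotalOrder.poset totalOrder)

  +-monoˡ-≤ : ∀ z {x y} → x ≤ y → x + z ≤ y + z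
  +-monoˡ-≤ z {x} {y} x≤y = begin
    x + z ≈⟨ +-comm x z ⟩
    z + x ≤⟨ +-monoʳ-≤ z x≤y ⟩
    z + y ≈⟨ +-comm z y ⟩
    y + z ∎

  +-cancelʳ-≤ : ∀ z {x y} → x + z ≤ y + z → x ≤ y
  +-cancelʳ-≤ z {x} {y} p = begin
    x           ≈⟨ //-rightDividesʳ z x ⟨
    x + z - z   ≤⟨ +-monoˡ-≤ (- z) p ⟩
    y + z - z   ≈⟨ //-rightDividesʳ z y ⟩
    y           ∎

  -- By totality a strict inequality is the negation of the reversed weak one, so strict laws follow
  -- from weak ones by contraposition.
  +-cancelʳ-< : ∀ z {x y} → x + z < y + z → x < y
  +-cancelʳ-< z p = ≰⇒> (<⇒≱ p ∘ +-monoˡ-≤ z)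

  +-monoʳ-< : ∀ z {x y} → x < y → z + x < z + y
  +-monoʳ-< z {x} {y} x<y = ≰⇒> λ p → <⇒≱ x<y (+-cancelʳ-≤ z (begin
    y + z ≈⟨ +-comm y z ⟩
    z + y ≤⟨ p ⟩
    z + x ≈⟨ +-comm z x ⟩
    x + z ∎))

  x≤y⇒0≤y-x : ∀ {x y} → x ≤ y → 0# ≤ y - x
  x≤y⇒0≤y-x {x} x≤y = ≤-respˡ-≈ (-‿inverseʳ x) (+-monoˡ-≤ (- x) x≤y)

  0≤y-x⇒x≤y : ∀ {x y} → 0# ≤ y - x → x ≤ y
  0≤y-x⇒x≤y {x} p = +-cancelʳ-≤ (- x) (≤-respˡ-≈ (sym (-‿inverseʳ x)) p)

  x<y⇒0<y-x : ∀ {x y} → x < y → 0# < y - x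
  x<y⇒0<y-x {x} {y} x<y = ≰⇒> λ p → <⇒≱ x<y
    (+-cancelʳ-≤ (- x) (≤-respʳ-≈ (sym (-‿inverseʳ x)) p))

  neg-mono-≤ : ∀ {x y} → x ≤ y → - y ≤ - x
  neg-mono-≤ {x} {y} x≤y = 0≤y-x⇒x≤y (begin
    0#          ≤⟨ x≤y⇒0≤y-x x≤y ⟩
    y - x       ≈⟨ +-comm y (- x) ⟩
    - x + y     ≈⟨ +-congˡ (-‿involutive y) ⟨
    - x - - y   ∎)

  neg-mono-< : ∀ {x y} → x < y → - y < - x
  neg-mono-< {x} {y} x<y = ≰⇒> λ p → <⇒≱ x<y (begin
    y     ≈⟨ -‿involutive y ⟨
    - - y ≤⟨ neg-mono-≤ p ⟩
    - - x ≈⟨ -‿involutive x ⟩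
    x     ∎)

  -x*-x≈x*x : ∀ x → - x * - x ≈ x * x
  -x*-x≈x*x x = begin-equality
    - x * - x     ≈⟨ -‿distribˡ-* x (- x) ⟨
    - (x * - x)   ≈⟨ -‿cong (-‿distribʳ-* x x) ⟨
    - - (x * x)   ≈⟨ -‿involutive (x * x) ⟩
    x * x         ∎

  0≤x*x : ∀ x → 0# ≤ x * x
  0≤x*x x with total 0# x
  ... | inj₁ 0≤x = *-nonneg 0≤x 0≤x
  ... | inj₂ x≤0 = ≤-respʳ-≈ (-x*-x≈x*x x) (*-nonneg 0≤-x 0≤-x)
    where
    0≤-x : 0# ≤ - x
    0≤-x = ≤-respˡ-≈ -0#≈0# (neg-mono-≤ x≤0)

  *-monoˡ-≤ : ∀ {x y z} → 0# ≤ z → x ≤ y → z * x ≤ z * y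
  *-monoˡ-≤ {x} {y} {z} 0≤z x≤y = 0≤y-x⇒x≤y
    (≤-respʳ-≈ (x[y-z]≈xy-xz z y x) (*-nonneg 0≤z (x≤y⇒0≤y-x x≤y)))

  0<x⇒0<x*x : ∀ {x} → 0# < x → 0# < x * x
  0<x⇒0<x*x {x} (0≤x , 0≉x) = *-nonneg 0≤x 0≤x , λ 0≈xx →
    let (y , xy≈1) = inverse x (0≉x ∘ sym) in
    0≉x (begin-equality
      0#          ≈⟨ zeroˡ y ⟨
      0# * y      ≈⟨ *-congʳ 0≈xx ⟩
      x * x * y   ≈⟨ *-assoc x x y ⟩
      x * (x * y) ≈⟨ *-congˡ xy≈1 ⟩
      x * 1#      ≈⟨ *-identityʳ x ⟩
      x           ∎)

  -- Replaces taking square roots, since moduli of complex numbers are available only in squared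
  -- form.
  x*x<y*y⇒x<y : ∀ {x y} → 0# ≤ y → x * x < y * y → x < y
  x*x<y*y⇒x<y {x} {y} 0≤y p = ≰⇒> λ y≤x → <⇒≱ p (begin
    y * y ≤⟨ *-monoˡ-≤ 0≤y y≤x ⟩
    y * x ≈⟨ *-comm y x ⟩
    x * y ≤⟨ *-monoˡ-≤ (≤-trans 0≤y y≤x) y≤x ⟩
    x * x ∎)

  1+1≉0 : ¬ 1# + 1# ≈ 0#
  1+1≉0 1+1≈0 = 0≉1 (antisym 0≤1 (begin
    1#      ≈⟨ +-identityʳ 1# ⟨
    1# + 0# ≤⟨ +-monoʳ-≤ 1# 0≤1 ⟩
    1# + 1# ≈⟨ 1+1≈0 ⟩
    0#      ∎))
    where
    0≤1 : 0# ≤ 1#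
    0≤1 = ≤-respʳ-≈ (*-identityˡ 1#) (0≤x*x 1#)

  halve : ∀ x → ∃[ y ] y + y ≈ x
  halve x = let (h , 2h≈1) = inverse (1# + 1#) 1+1≉0 in h * x , (begin-equality
    h * x + h * x       ≈⟨ distribʳ x h h ⟨
    (h + h) * x         ≈⟨ *-congʳ (+-cong (*-identityˡ h) (*-identityˡ h)) ⟨
    (1# * h + 1# * h) * x ≈⟨ *-congʳ (distribʳ h 1# 1#) ⟨
    (1# + 1#) * h * x   ≈⟨ *-congʳ 2h≈1 ⟩
    1# * x              ≈⟨ *-identityˡ x ⟩
    x                   ∎)

  -- The midpoint works: `e` is half the gap. It later serves as a threshold between two distinct
  -- values.
  dense : ∀ {x y} → x < y → ∃[ m ] (x < m × m < y)
  dense {x} {y} x<y = x + e , <-respˡ-≈ (+-identityʳ x) x+0<x+e , <-respʳ-≈ x+e+e≈y x+e<x+e+e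
    where
    e = proj₁ (halve (y - x))
    e+e≈y-x = proj₂ (halve (y - x))

    0<e : 0# < e
    0<e = ≰⇒> λ e≤0 → <⇒≱ (x<y⇒0<y-x x<y) (begin
      y - x   ≈⟨ e+e≈y-x ⟨
      e + e   ≤⟨ +-monoˡ-≤ e e≤0 ⟩
      0# + e  ≈⟨ +-identityˡ e ⟩
      e       ≤⟨ e≤0 ⟩
      0#      ∎)

    x+0<x+e : x + 0# < x + e
    x+0<x+e = +-monoʳ-< x 0<e

    x+e<x+e+e : x + e < x + e + e
    x+e<x+e+e = <-respˡ-≈ (+-identityʳ (x + e)) (+-monoʳ-< (x + e) 0<e)

    x+e+e≈y : x + e + e ≈ y
    x+e+e≈y = begin-equality
      x + e + e    ≈⟨ +-assoc x e e ⟩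
      x + (e + e)  ≈⟨ +-congˡ e+e≈y-x ⟩
      x + (y - x)  ≈⟨ +-assoc x y (- x) ⟨
      x + y - x    ≈⟨ xyx⁻¹≈y x y ⟩
      y            ∎

  positive-lowerBound : ∀ {x y} → 0# < x → 0# < y → ∃[ z ] (0# < z × z ≤ x × z ≤ y)
  positive-lowerBound {x} {y} 0<x 0<y with total x y
  ... | inj₁ x≤y = x , 0<x , ≤-refl , x≤y
  ... | inj₂ y≤x = y , 0<y , y≤x , ≤-refl

  <-≤-trans : ∀ {x y z} → x < y → y ≤ z → x < z
  <-≤-trans {x} {y} {z} x<y y≤z = begin-strict
    x <⟨ x<y ⟩
    y ≤⟨ y≤z ⟩
    z ∎

-- Real coordinates on the complex plane.

module Coordinates {ℓ} (ℝ : CompleteOrderedField ℓ) where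
  open CompleteOrderedField ℝ
  open OrderedFieldProperties ℝ
  open PartialOrderReasoning (TotalOrder.poset totalOrder)
  open Complex ℝ using (∣_∣²)
  private module ℂ = CommutativeRing (Complex.commutativeRing ℝ)

  -- Abstracts ± re and ± im: the half-planes f < m for these four f separate points of ℂ.
  record Coordinate : Set ℓ where
    field
      ⟨_⟩      : ℂ.Carrier → Carrier
      ⟨⟩-cong  : ∀ {z w} → z ℂ.≈ w → ⟨ z ⟩ ≈ ⟨ w ⟩
      ⟨⟩-minus : ∀ z w → ⟨ z ℂ.- w ⟩ ≈ ⟨ z ⟩ - ⟨ w ⟩
      ⟨⟩-short : ∀ z → ⟨ z ⟩ * ⟨ z ⟩ ≤ ∣ z ∣²

  open Coordinate

  re : Coordinate
  re = record
    { ⟨_⟩      = proj₁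
    ; ⟨⟩-cong  = proj₁
    ; ⟨⟩-minus = λ _ _ → refl
    ; ⟨⟩-short = λ (a , b) → ≤-respˡ-≈ (+-identityʳ (a * a)) (+-monoʳ-≤ (a * a) (0≤x*x b))
    }

  im : Coordinate
  im = record
    { ⟨_⟩      = proj₂
    ; ⟨⟩-cong  = proj₂
    ; ⟨⟩-minus = λ _ _ → refl
    ; ⟨⟩-short = λ (a , b) → ≤-respˡ-≈ (+-identityˡ (b * b)) (+-monoˡ-≤ (b * b) (0≤x*x a))
    }

  negate : Coordinate → Coordinate
  negate f = record
    { ⟨_⟩      = λ z → - ⟨ f ⟩ z
    ; ⟨⟩-cong  = -‿cong ∘ ⟨⟩-cong f
    ; ⟨⟩-minus = λ z w → trans (-‿cong (⟨⟩-minus f z w)) (sym (-‿+-comm _ _))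
    ; ⟨⟩-short = λ z → ≤-respˡ-≈ (sym (-x*-x≈x*x (⟨ f ⟩ z))) (⟨⟩-short f z)
    }

  -- Open half-planes are open: with `d` the gap between the value at `z` and `m`, the radius is
  -- `d * d` because `∣_∣²` is squared, and by `⟨⟩-short` the coordinate moves by less than `d`.
  <-stable : ∀ (f : Coordinate) {z m} → ⟨ f ⟩ z < m →
             ∃[ ε ] (0# < ε × ∀ w → ∣ w ℂ.- z ∣² < ε → ⟨ f ⟩ w < m)
  <-stable f {z} {m} fz<m = d * d , 0<x⇒0<x*x 0<d , λ w ∣w-z∣²<dd →
    let fw-fz<d = <-respˡ-≈ (⟨⟩-minus f w z)
          (x*x<y*y⇒x<y (proj₁ 0<d) (begin-strict
            ⟨ f ⟩ (w ℂ.- z) * ⟨ f ⟩ (w ℂ.- z) ≤⟨ ⟨⟩-short f (w ℂ.- z) ⟩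
            ∣ w ℂ.- z ∣²                      <⟨ ∣w-z∣²<dd ⟩
            d * d                             ∎))
    in +-cancelʳ-< (- ⟨ f ⟩ z) fw-fz<d
    where
    d = m - ⟨ f ⟩ z
    0<d = x<y⇒0<y-x fz<m

-- Open sets of the spectrum and its Hausdorff property.

module SpectrumTopology {ℓ} {ℝ : CompleteOrderedField ℓ} (A : CStarAlgebra ℝ) where
  private
    module ℝ = CompleteOrderedField ℝ
    module A = CStarAlgebra A
    module ℂ = CommutativeRing (Complex.commutativeRing ℝ)
  open OrderedFieldProperties ℝ
    using (total; <-asym; <-respˡ-≈; <-≤-trans; neg-mono-<; dense; positive-lowerBound)
  open Coordinates ℝ
  open Coordinate
  open MeasurementOutcomes A
  open CommSubalgebra using (Element)
  open Character using (⟦_⟧)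

  ≐-sym : ∀ {C} {σ ρ : Character C} → σ ≐ ρ → ρ ≐ σ
  ≐-sym σ≐ρ a = ℂ.sym (σ≐ρ a)

  ≐-trans : ∀ {C} {σ ρ χ : Character C} → σ ≐ ρ → ρ ≐ χ → σ ≐ χ
  ≐-trans σ≐ρ ρ≐χ a = ℂ.trans (σ≐ρ a) (ρ≐χ a)

  r-cong : ∀ {C D} (C⊑D : C ⊑ D) {σ ρ : Character D} → σ ≐ ρ →
           r {C} {D} C⊑D σ ≐ r C⊑D ρ
  r-cong C⊑D σ≐ρ (a , p) = σ≐ρ (a , C⊑D p)

  ≋-refl : ∀ {C} → C ≋ C
  ≋-refl = Poset.Eq.refl 𝒞

  -- Restricting along the identity rebuilds the proof fields of `σ`, so the result agrees with `σ`
  -- only up to `≐`, under which opens are invariant.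
  r-id : ∀ {C} (u : Open C) {σ} → σ ∈ points u → r (λ p → p) σ ∈ points u
  r-id u {σ} = Open.respects u (λ _ → Character.cong σ A.refl)

  infixr 7 _∩_
  _∩_ : ∀ {C} → Open C → Open C → Open C
  u ∩ v = record
    { points   = λ σ → σ ∈ points u × σ ∈ points v
    ; respects = λ σ≐ρ (p , q) → Open.respects u σ≐ρ p , Open.respects v σ≐ρ q
    ; isOpen   = λ (p , q) →
        let (as , ε , 0<ε , near-u) = Open.isOpen u p
            (bs , δ , 0<δ , near-v) = Open.isOpen v q
            (γ , 0<γ , γ≤ε , γ≤δ) = positive-lowerBound 0<ε 0<δ
        in as ++ bs , γ , 0<γ , λ near →
             let (near-as , near-bs) = ++⁻ as near in
             near-u (All.map (λ lt → <-≤-trans lt γ≤ε) near-as) ,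
             near-v (All.map (λ lt → <-≤-trans lt γ≤δ) near-bs)
    }

  r⁻¹ : ∀ {C D} → C ⊑ D → Open C → Open D
  r⁻¹ {C} {D} C⊑D u = record
    { points   = λ σ → r C⊑D σ ∈ points u
    ; respects = λ {σ} {ρ} σ≐ρ → Open.respects u (r-cong {C} C⊑D {σ} {ρ} σ≐ρ)
    ; isOpen   = λ p →
        let (as , ε , 0<ε , near) = Open.isOpen u p in
        -- Restriction keeps values, so the same elements, viewed in `D`, and the same radius work.
        map (λ (a , a∈C) → a , C⊑D a∈C) as , ε , 0<ε , near ∘ map⁻
    }

  halfSpace : ∀ {C} → Coordinate → Element C → ℝ.Carrier → Open C
  halfSpace f a m = record
    { points   = λ σ → ⟨ f ⟩ (⟦ σ ⟧ a) ℝ.< m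
    ; respects = λ σ≐ρ → <-respˡ-≈ (⟨⟩-cong f (σ≐ρ a))
    ; isOpen   = λ fσa<m →
        let (ε , 0<ε , near) = <-stable f fσa<m in
        a ∷ [] , ε , 0<ε , λ { (lt ∷ []) → near _ lt }
    }

  Separated : ∀ {C} → Character C → Character C → Set (suc ℓ)
  Separated {C} σ ρ = Σ[ u ∈ Open C ] Σ[ v ∈ Open C ]
    (σ ∈ points u × ρ ∈ points v × ¬ (points u ≬ points v))

  separated-sym : ∀ {C} {σ ρ : Character C} → Separated σ ρ → Separated ρ σ
  separated-sym (u , v , σ∈u , ρ∈v , disjoint) =
    v , u , ρ∈v , σ∈u , λ (χ , χ∈v , χ∈u) → disjoint (χ , χ∈u , χ∈v)

  -- A threshold `m` strictly between the two values cuts the spectrum into disjoint half-spaces;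
  -- the upper one is encoded as a lower one for the negated coordinate.
  separate : ∀ {C} {σ ρ : Character C} (f : Coordinate) (a : Element C) →
             ⟨ f ⟩ (⟦ σ ⟧ a) ℝ.< ⟨ f ⟩ (⟦ ρ ⟧ a) → Separated σ ρ
  separate f a fσa<fρa =
    let (m , fσa<m , m<fρa) = dense fσa<fρa in
    halfSpace f a m , halfSpace (negate f) a (ℝ.- m) , fσa<m , neg-mono-< m<fρa ,
    λ (χ , fχa<m , -fχa<-m) → <-asym (neg-mono-< fχa<m) -fχa<-m

  module _ (em : ExcludedMiddle (suc ℓ)) where

    -- If the characters are not separated, then at no element can the real or imaginary parts
    -- differ: by totality a difference is a strict inequality one way or the other, and `separate`
    -- would apply.
    hausdorff : ∀ {C} (σ ρ : Character C) → Separated σ ρ ⊎ σ ≐ ρ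
    hausdorff σ ρ = case em {Separated σ ρ} of λ where
        (yes s) → inj₁ s
        (no ¬s) → inj₂ λ a → agree ¬s re a , agree ¬s im a
      where
      agree : ¬ Separated σ ρ → ∀ f a → ⟨ f ⟩ (⟦ σ ⟧ a) ℝ.≈ ⟨ f ⟩ (⟦ ρ ⟧ a)
      agree ¬s f a = decidable-stable (map′ lower lift em) λ ≉ →
        case total (⟨ f ⟩ (⟦ σ ⟧ a)) (⟨ f ⟩ (⟦ ρ ⟧ a)) of λ where
          (inj₁ ≤) → ¬s (separate {σ = σ} {ρ} f a (≤ , ≉))
          (inj₂ ≥) → ¬s (separated-sym {σ = ρ} {σ} (separate {σ = ρ} {σ} f a (≥ , ≉ ∘ ℝ.sym)))

module PointsAndIdeals {ℓ} {ℝ : CompleteOrderedField ℓ} (A : CStarAlgebra ℝ) where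
  private
    module A = CStarAlgebra A
  open MeasurementOutcomes A
  open SpectrumTopology A

  -- From points to consistent ideals.

  module _ (em : ExcludedMiddle (suc ℓ)) (τ : Point 𝒞⋉Σ) where
    open Point τ

    I-of-mem : ∀ {C u} → (C , u) ∈ filter → C ∈ I τ
    I-of-mem = upClosed ((λ p → p) , λ _ → tt)

    -- A character in the open part of a common lower bound restricts to `D` as a common element.
    -- Without such elements that open part is empty, hence covered by the empty family,
    -- contradicting primeness. Two algebras are allowed because primeness returns an open over some
    -- `D` that is only `≋` to `C`.
    meets : ∀ {C D u v} (C⊑D : C ⊑ D) → (C , u) ∈ filter → (D , v) ∈ filter →
            ¬ ¬ (points (r⁻¹ C⊑D u) ≬ points v)
    meets {u = u} C⊑D Cu∈τ Dv∈τ disjoint =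
      let (E , w) , Ew∈τ , (C⊑E , w⊆u) , (D⊑E , w⊆v) = filtered Cu∈τ Dv∈τ
          _ , ∈∅ , _ = prime (λ _ → ⊥) Ew∈τ
            ((λ _ _ ()) , λ χ χ∈w → contradiction
              (r D⊑E χ , Open.respects u (λ _ → Character.cong χ A.refl) (w⊆u χ∈w) , w⊆v χ∈w)
              disjoint)
      in case ∈∅ of λ ()

    neighbourhoods⊆filter : ∀ {C} → C ∈ I τ →
      Σ[ σ ∈ Character C ] (∀ u → σ ∈ points u → (C , u) ∈ filter)
    neighbourhoods⊆filter {C} C∈I = decidable-stable em λ none →
      let (D , v) , (_ , Dv∉τ) , Dv∈τ =
            -- The covering family consists of all opens outside the filter, over every algebra `≋`
            -- to `C`.
            prime (λ (D , v) → D ≋ C × ¬ (D , v) ∈ filter) C∈I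
              ( (λ _ _ (D≋C , _) → Symmetric.rhs≤lhs D≋C)
              , λ σ _ → case em {∃[ u ] (σ ∈ points u × ¬ (C , u) ∈ filter)} of λ where
                  (yes (u , σ∈u , Cu∉τ)) →
                    C , u , ≋-refl , (≋-refl , Cu∉τ) , r-id u σ∈u
                  (no ¬∃) → contradiction
                    (σ , λ u σ∈u → decidable-stable em λ Cu∉τ → ¬∃ (u , σ∈u , Cu∉τ)) none)
      in Dv∉τ Dv∈τ

    determined : ∀ {C} → C ∈ I τ → ∃[ σ ] Determines τ {C} σ
    determined {C} C∈I = σ , λ u → mk⇔ (filter⊆neighbourhoods u) (nbhd⊆ u)
      where
      σ = proj₁ (neighbourhoods⊆filter C∈I)
      nbhd⊆ = proj₂ (neighbourhoods⊆filter C∈I)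

      filter⊆neighbourhoods : ∀ u → (C , u) ∈ filter → σ ∈ points u
      -- Membership in an open lives at level `ℓ`, one below excluded middle, hence `lift` and
      -- `lower`.
      filter⊆neighbourhoods u Cu∈τ = lower (decidable-stable em λ σ∉u →
        let (D , v) , (D≋C , w , σ∈w , disjoint) , Dv∈τ =
              -- Since `w` is over `C` and `v` over `D`, disjointness is stated after pulling `w`
              -- back to `D`.
              prime (λ (D , v) → Σ[ D≋C ∈ D ≋ C ] Σ[ w ∈ Open C ]
                       (σ ∈ points w × ¬ (points (r⁻¹ (Symmetric.rhs≤lhs D≋C) w) ≬ points v)))
                Cu∈τ
                ( (λ _ _ (D≋C , _) → Symmetric.rhs≤lhs D≋C)
                , λ ρ ρ∈u → case hausdorff em σ ρ of λ where
                    (inj₁ (w , v , σ∈w , ρ∈v , disjoint)) →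
                      C , v , ≋-refl ,
                      (≋-refl , w , σ∈w , λ (χ , χ∈w , χ∈v) → disjoint
                        (χ , Open.respects w (λ _ → Character.cong χ A.refl) χ∈w , χ∈v)) ,
                      r-id v ρ∈v
                    (inj₂ σ≐ρ) → contradiction
                      (lift (Open.respects u (≐-sym {σ = σ} {ρ} σ≐ρ) ρ∈u)) σ∉u)
        in meets (Symmetric.rhs≤lhs D≋C) (nbhd⊆ w σ∈w) Dv∈τ disjoint)

    determines⇒I : ∀ {C σ} → Determines τ {C} σ → C ∈ I τ
    determines⇒I {C} det = from (det (full C)) tt

    -- If `u` and `v` separated the characters, `u` would be in the filter because of `σ` and so
    -- contain `ρ`, which also lies in `v`.
    determines-unique : ∀ {C} {σ ρ : Character C} → Determines τ σ → Determines τ ρ → σ ≐ ρ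
    determines-unique {σ = σ} {ρ} detσ detρ = case hausdorff em σ ρ of λ where
      (inj₁ (u , v , σ∈u , ρ∈v , disjoint)) → contradiction
        (ρ , to (detρ u) (from (detσ u) σ∈u) , ρ∈v) disjoint
      (inj₂ σ≐ρ) → σ≐ρ

    determines-resp : ∀ {C} {σ ρ : Character C} → σ ≐ ρ → Determines τ σ → Determines τ ρ
    determines-resp {σ = σ} {ρ} σ≐ρ det u = mk⇔
      (Open.respects u σ≐ρ ∘ to (det u))
      (from (det u) ∘ Open.respects u (≐-sym {σ = σ} {ρ} σ≐ρ))

    -- An open over `C` is in the filter exactly when its pullback to `D` is. Backwards this is
    -- up-closure; forwards, a common lower bound with `full D` lies below the pullback.
    determines-restrict : ∀ {C D} (C⊑D : C ⊑ D) {ρ : Character D} →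
                          Determines τ ρ → Determines τ (r {C} C⊑D ρ)
    determines-restrict {C} {D} C⊑D det u = mk⇔
      (λ Cu∈τ →
        let (E , w) , Ew∈τ , (C⊑E , w⊆u) , (D⊑E , _) = filtered Cu∈τ (determines⇒I det) in
        to (det (r⁻¹ C⊑D u)) (upClosed
          (D⊑E , λ {χ} χ∈w → Open.respects u (λ _ → Character.cong χ A.refl) (w⊆u χ∈w)) Ew∈τ))
      (λ rρ∈u → upClosed {D , r⁻¹ C⊑D u} (C⊑D , λ χ∈ → χ∈) (from (det (r⁻¹ C⊑D u)) rρ∈u))

    ideal : ConsistentIdeal
    ideal = record
      { outcomes   = λ (_ , σ) → Determines τ σ
      ; respects   = λ {(C , σ)} {(D , ρ)} (C≋D , σ≐rρ) det →
          let D⊑C = Symmetric.rhs≤lhs C≋D ; C⊑D = Symmetric.lhs≤rhs C≋D in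
          -- Restricting `σ` to `D` gives a determined character, and it agrees with `ρ` because `ρ`
          -- restricted to `C` and back has unchanged values.
          determines-resp
            {σ = r D⊑C σ} {ρ}
            (≐-trans {σ = r D⊑C σ} {r {D} D⊑C (r {C} C⊑D ρ)} {ρ}
              (r-cong {D} D⊑C {σ} {r C⊑D ρ} σ≐rρ) λ _ → Character.cong ρ A.refl)
            (determines-restrict {D} D⊑C {σ} det)
      ; nonempty   = let (C , _) , ∈τ = inhabited in C , determined (I-of-mem ∈τ)
      ; downClosed = λ {C} C⊑D (ρ , det) → r C⊑D ρ , determines-restrict {C} C⊑D {ρ} det
      ; directed   = λ (_ , detC) (_ , detD) →
          let (E , _) , ∈τ , (C⊑E , _) , (D⊑E , _) =
                filtered (determines⇒I detC) (determines⇒I detD)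
          in E , determined (I-of-mem ∈τ) , C⊑E , D⊑E
      ; unique     = determines-unique
      ; consistent = λ {C} {σ = σ} {ρ} detσ detρ C⊑D →
          determines-unique {σ = σ} {r C⊑D ρ} detσ (determines-restrict {C} C⊑D {ρ} detρ)
      }

  -- From consistent ideals to points.

  module _ (F : ConsistentIdeal) where
    private module F = ConsistentIdeal F

    -- Down-closure yields merely some outcome at `C`; consistency identifies its character with the
    -- restriction.
    restrict∈outcomes : ∀ {C D} (C⊑D : C ⊑ D) {ρ} → (D , ρ) ∈ outcomes F → (C , r C⊑D ρ) ∈ outcomes F
    restrict∈outcomes C⊑D {ρ} ρ∈F =
      let σ , σ∈F = F.downClosed C⊑D (ρ , ρ∈F) in
      F.respects (≋-refl , F.consistent σ∈F ρ∈F C⊑D) σ∈F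

    point : Point 𝒞⋉Σ
    point = record
      { filter    = λ (C , u) → ∃[ σ ] ((C , σ) ∈ outcomes F × σ ∈ points u)
      ; inhabited = let C , σ , σ∈F = F.nonempty in (C , full C) , σ , σ∈F , tt
      ; upClosed  = λ (C⊑D , v⊆u) (ρ , ρ∈F , ρ∈v) →
          r C⊑D ρ , restrict∈outcomes C⊑D ρ∈F , v⊆u ρ∈v
      ; filtered  = λ {(C , u)} {(D , v)} (σ , σ∈F , σ∈u) (ρ , ρ∈F , ρ∈v) →
          let E , (χ , χ∈F) , C⊑E , D⊑E = F.directed (σ , σ∈F) (ρ , ρ∈F) in
          -- Both opens are pulled back to the larger algebra `E` and intersected; by consistency
          -- `χ` restricts to `σ` and to `ρ`, so it lies in the intersection.
          (E , r⁻¹ C⊑E u ∩ r⁻¹ D⊑E v) ,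
          (χ , χ∈F ,
            Open.respects u (F.consistent σ∈F χ∈F C⊑E) σ∈u ,
            Open.respects v (F.consistent ρ∈F χ∈F D⊑E) ρ∈v) ,
          (C⊑E , proj₁) , (D⊑E , proj₂)
      ; prime     = λ S (σ , σ∈F , σ∈u) (_ , cover) →
          -- The cover is evaluated at the character `σ` itself, and the member containing it is the
          -- one required.
          let D , v , D≋C , Dv∈S , rσ∈v = cover σ σ∈u
              D⊑C = Symmetric.lhs≤rhs D≋C
          in (D , v) , Dv∈S , r D⊑C σ , restrict∈outcomes D⊑C σ∈F , rσ∈v
      }

    -- Membership in `point` provides some outcome at `C`, which uniqueness identifies with `σ`.
    outcome-determines : ∀ {C σ} → (C , σ) ∈ outcomes F → Determines point σ
    outcome-determines {σ = σ} σ∈F u = mk⇔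
      (λ (ρ , ρ∈F , ρ∈u) → Open.respects u (F.unique ρ∈F σ∈F) ρ∈u)
      (λ σ∈u → σ , σ∈F , σ∈u)

  -- The two constructions are mutually inverse.

  correspondence : ExcludedMiddle (suc ℓ) → Inverse (pointSetoid 𝒞⋉Σ) idealSetoid
  correspondence em = record
    { to        = ideal em
    ; from      = point
    ; to-cong   = λ {τ} {υ} → to-cong {τ} {υ}
    ; from-cong = λ {F} {G} → from-cong {F} {G}
    ; inverse   =
        -- The inverse laws are required for every argument equivalent to an image, so congruence
        -- first reduces them to the round trips below.
        (λ {F} {τ} τ≈ → ≈.trans {ideal em τ} {ideal em (point F)} {F}
                          (to-cong {τ} {point F} τ≈) (ideal∘point F)) ,
        (λ {τ} {F} F≈ → ≈ₚ.trans {point F} {point (ideal em τ)} {τ}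
                          (from-cong {F} {ideal em τ} F≈) (point∘ideal τ))
    }
    where
    module ≈ = Setoid idealSetoid
    module ≈ₚ = Setoid (pointSetoid 𝒞⋉Σ)

    to-cong : ∀ {τ υ} → τ ≈ₚ.≈ υ → ideal em τ ≈.≈ ideal em υ
    to-cong τ≈υ (C , _) = mk⇔
      (λ det u → mk⇔ (to (det u) ∘ from (τ≈υ (C , u))) (to (τ≈υ (C , u)) ∘ from (det u)))
      (λ det u → mk⇔ (to (det u) ∘ to (τ≈υ (C , u))) (from (τ≈υ (C , u)) ∘ from (det u)))

    from-cong : ∀ {F G} → F ≈.≈ G → point F ≈ₚ.≈ point G
    from-cong F≈G (C , _) = mk⇔
      (λ (σ , σ∈F , σ∈u) → σ , to (F≈G (C , σ)) σ∈F , σ∈u)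
      (λ (σ , σ∈G , σ∈u) → σ , from (F≈G (C , σ)) σ∈G , σ∈u)

    ideal∘point : ∀ F → ideal em (point F) ≈.≈ F
    ideal∘point F (C , σ) = mk⇔
      (λ det →
        -- That `full C` is in the filter of `point F` means that `F` has an outcome `ρ` at `C`.
        -- Both `ρ` and `σ` are determined by the point, hence equal.
        let ρ , ρ∈F , _ = determines⇒I em (point F) {σ = σ} det in
        ConsistentIdeal.respects F
          (≋-refl , determines-unique em (point F) {σ = ρ} {σ} (outcome-determines F ρ∈F) det) ρ∈F)
      (outcome-determines F)

    point∘ideal : ∀ τ → point (ideal em τ) ≈ₚ.≈ τ
    point∘ideal τ (C , u) = mk⇔
      (λ (σ , det , σ∈u) → from (det u) σ∈u)
      (λ Cu∈τ → let σ , det = determined em τ (I-of-mem em τ Cu∈τ) in σ , det , to (det u) Cu∈τ)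

theorem4p3 : ∀ {ℓ : Level} → ExcludedMiddle (suc ℓ) →
  (ℝ : CompleteOrderedField ℓ) (A : CStarAlgebra ℝ) →
  let open MeasurementOutcomes A in
  Σ[ correspondence ∈ Inverse (pointSetoid 𝒞⋉Σ) idealSetoid ]
    ((∀ τ → (∀ C → C ∈ Index (Inverse.to correspondence τ) ⇔ C ∈ I τ) ×
            (∀ C → C ∈ I τ →
              Σ[ σ ∈ Character C ]
                ((C , σ) ∈ outcomes (Inverse.to correspondence τ) ×
                 Determines τ σ ×
                 (∀ ρ → Determines τ ρ → ρ ≐ σ)))) ×
     (∀ F C (u : Open C) →
       (C , u) ∈ Point.filter (Inverse.from correspondence F) ⇔
       (∃[ σ ] ((C , σ) ∈ outcomes F × σ ∈ points u))))
theorem4p3 em ℝ A =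
  correspondence em ,
  (λ τ →
    (λ C → mk⇔ (λ (σ , det) → determines⇒I em τ {σ = σ} det) (determined em τ)) ,
    (λ C C∈I →
      let σ , det = determined em τ C∈I in
      σ , det , det , λ ρ detρ → determines-unique em τ {σ = ρ} {σ} detρ det)) ,
  (λ F C u → mk⇔ (λ p → p) (λ p → p))
  where open PointsAndIdeals A
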